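{- Let $k,m,d,a$ be positive integers. For each positive integer $n$, consider the $k$-dimensional chessboard of side length $n$ with $dn^{k-m}$ attacking pieces placed at random on it, where a piece, wherever it is placed, attacks $an^m$ spaces. Let $S_{n,k}$ be the number of safe spaces. Then the variance of the proportion of safe spaces $S_{n,k}/n^k$ (the random variable with mean $\mu_{n,k}$) approaches $0$ as $n\to\infty$.
   Context: The $k$-dimensional board of side length $n$ is the set of spaces $\{1,\dots,n\}^k$. For each $n$ the type of piece is given by an attack rule assigning to each space $p$ the set $A_n(p)$ of spaces attacked by a piece at $p$; the space $p$ itself is counted as attacked by the piece at $p$ (so $p\in A_n(p)$), and $|A_n(p)|=an^m$ for every $p$. "Placing $N$ pieces at random" means that the set of occupied spaces (the board configuration) is chosen uniformly among all subsets of $N$ distinct spaces; here $N=dn^{k-m}$ (and $n$ is taken large enough that this is possible). A space is safe under a board configuration if it lies in none of the sets $A_n(p)$ with $p$ occupied. $S_{n,k}$ is the number of safe spaces and $\mu_{n,k}=\mathbb{E}[S_{n,k}]/n^k$ is the expected proportion of safe spaces. -}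

module Defs where

open import Data.Fin using (Fin)
open import Data.Integer using (+_)
open import Data.List using (List; []; _∷_; [_]; _++_; map; length; filter; foldr; allFin; cartesianProductWith)
open import Data.List.Relation.Unary.All using (All; all?)
open import Data.Nat using (ℕ; zero; suc; _^_; _≥_; NonZero)
open import Data.Nat.Properties using (m^n≢0)
open import Data.Product using (∃)
open import Data.Rational using (ℚ; 0ℚ; _+_; _-_; _*_; _/_; _<_; ∣_∣)
open import Data.Vec using (Vec; []; _∷_)
open import Level using (0ℓ)
open import Relation.Binary using (Rel; Decidable; Reflexive)
open import Relation.Nullary using (¬_; ¬?)
import Relation.Unary as U

private
  variable
    X : Set

Space : ℕ → ℕ → Set
Space k n = Vec (Fin n) k

spaces : ∀ k n → List (Space k n)
spaces zero    n = [ [] ]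
spaces (suc k) n = cartesianProductWith _∷_ (allFin n) (spaces k n)

-- `p attacks q` means q ∈ Aₙ(p).  Decidability makes each Aₙ(p) a genuine
-- finite subset of the board; the relation need not be symmetric.
record AttackRule (k n : ℕ) : Set₁ where
  field
    _attacks_   : Rel (Space k n) 0ℓ
    _attacks?_  : Decidable _attacks_
    attacksSelf : Reflexive _attacks_

  attackCount : Space k n → ℕ
  attackCount p = length (filter (p attacks?_) (spaces k n))

  Safe : List (Space k n) → Space k n → Set
  Safe occupied q = All (λ p → ¬ (p attacks q)) occupied

  safe? : ∀ occupied → U.Decidable (Safe occupied)
  safe? occupied q = all? (λ p → ¬? (p attacks? q)) occupied

  safeCount : List (Space k n) → ℕ
  safeCount occupied = length (filter (safe? occupied) (spaces k n))

  safeProportion : .{{_ : NonZero n}} → List (Space k n) → ℚ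
  safeProportion occupied = (+ safeCount occupied / n ^ k) {{m^n≢0 n k}}

open AttackRule public

-- Sublists of length N.  For a duplicate-free list, these enumerate its
-- N-element subsets, each exactly once.
choose : ℕ → List X → List (List X)
choose zero    xs       = [ [] ]
choose (suc N) []       = []
choose (suc N) (x ∷ xs) = map (x ∷_) (choose N xs) ++ choose (suc N) xs

placements : ∀ k n → ℕ → List (List (Space k n))
placements k n N = choose N (spaces k n)

sumℚ : List ℚ → ℚ
sumℚ = foldr _+_ 0ℚ

-- Expectation under the uniform distribution on the entries of Ω.  The value
-- for empty Ω is a convention: `placements k n N` is empty only if N > n ^ k.
𝔼 : List X → (X → ℚ) → ℚ
𝔼 []          f = 0ℚ
𝔼 Ω@(_ ∷ Ω′) f = sumℚ (map f Ω) * (+ 1 / suc (length Ω′))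

Var : List X → (X → ℚ) → ℚ
Var Ω f = 𝔼 Ω (λ ω → (f ω - 𝔼 Ω f) * (f ω - 𝔼 Ω f))

-- Convergence of a sequence indexed by the positive integers.  For a rational
-- sequence and limit, testing rational ε is the same as testing real ε.
_⟶_ : (∀ n → .{{NonZero n}} → ℚ) → ℚ → Set
u ⟶ L = ∀ ε → 0ℚ < ε → ∃ λ n₁ → ∀ n → .{{_ : NonZero n}} → n ≥ n₁ → ∣ u n - L ∣ < ε

{-# OPTIONS --safe #-}
module Submission where

-- The number S of safe spaces is a sum of indicators, one for each space q, of the
-- event that no piece lies in B(q) = {p : p attacks q}.  The probability of missing a
-- given set of b spaces is C(M - b, N) / C(M, N), where M = n ^ k.  Log-concavity of
-- x ↦ C(x, N) says that missing two disjoint sets is negatively correlated, so with the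
-- union bound the covariance of the events for q and q′ is at most |B(q) ∩ B(q′)| N / M.
-- Summing over q and q′, double counting gives Σ |B(q) ∩ B(q′)| = Σ |A(p)|² = M (a n^m)²,
-- whence Var(S / M) ≤ N (a n^m)² / M² = d a² n^(m - k), which tends to 0 if m < k.
-- If m ≥ k then a single piece attacks the whole board and S = 0.

open import Data.Bool using (Bool; true; false; not; _∧_)
open import Data.Bool.ListAction using (all)
import Data.Integer as ℤ
import Data.Integer.Properties as ℤ
open import Data.List using (List; []; _∷_; _++_; map; length; filter; allFin; cartesianProductWith)
open import Data.List.Properties using (map-∘; map-++; length-map; length-++; length-tabulate)
open import Data.Nat
open import Data.Nat.Combinatorics
open import Data.Nat.ListAction using (sum)
open import Data.Nat.ListAction.Properties using (sum-++)
open import Data.Nat.Properties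
open import Data.Nat.Tactic.RingSolver using (solve-∀)
open import Data.Product using (∃; _×_; _,_)
open import Data.Rational as ℚ using (ℚ; 0ℚ; 1ℚ; mkℚ; toℚᵘ; *<*)
open import Data.Rational.Literals using (fromℤ)
import Data.Rational.Properties as ℚ
open import Data.Rational.Solver using (module +-*-Solver)
import Data.Rational.Unnormalised as ℚᵘ
import Data.Rational.Unnormalised.Properties as ℚᵘ
import Data.Vec as Vec
open import Function using (_∘_; const; id)
open import Level using (0ℓ)
open import Relation.Binary.PropositionalEquality hiding ([_])
open import Relation.Nullary using (yes; no; does)
open import Relation.Unary using (Pred; Decidable)
open import Defs

private
  variable
    X Y : Set

-- Binomial coefficients: log-concavity, union bound and covariance.

nC0≡1 : ∀ n → n C 0 ≡ 1
nC0≡1 n = trans (nCk≡nC[n∸k] {0} {n} z≤n) (nCn≡1 n)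

0C[1+k]≡0 : ∀ k → 0 C suc k ≡ 0
0C[1+k]≡0 k = k>n⇒nCk≡0 (z<s {k})

-- Pascal's rule splits the left side into the two instances below it, and the induction hypotheses
-- recombine. Both arguments drop by one at the price of a linear factor, which drives the recursion
-- in `C-logConcave` and produces the error term of `C-unionBound`.
C-absorption : ∀ n k → suc k * (suc n C suc k) ≡ suc n * (n C k)
C-absorption zero    zero    = refl
C-absorption zero    (suc k) = begin
  suc (suc k) * (1 C suc (suc k)) ≡⟨ cong (suc (suc k) *_) (k>n⇒nCk≡0 (s<s (z<s {k}))) ⟩
  suc (suc k) * 0                 ≡⟨ *-zeroʳ (suc (suc k)) ⟩
  0                               ≡⟨ cong (1 *_) (0C[1+k]≡0 k) ⟨
  1 * (0 C suc k)                 ∎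
  where open ≡-Reasoning
C-absorption (suc n) zero    = begin
  1 * (suc (suc n) C 1)      ≡⟨ cong (1 *_) (nC1≡n (suc (suc n))) ⟩
  1 * suc (suc n)            ≡⟨ *-comm 1 (suc (suc n)) ⟩
  suc (suc n) * 1            ≡⟨ cong (suc (suc n) *_) (nC0≡1 (suc n)) ⟨
  suc (suc n) * (suc n C 0)  ∎
  where open ≡-Reasoning
C-absorption (suc n) (suc k) = begin
  suc (suc k) * (suc (suc n) C suc (suc k))
    ≡⟨ cong (suc (suc k) *_) (nCk+nC[k+1]≡[n+1]C[k+1] (suc n) (suc k)) ⟨
  suc (suc k) * (c + (suc n C suc (suc k)))
    ≡⟨ distrib (suc k) c _ ⟩
  suc k * c + c + suc (suc k) * (suc n C suc (suc k))
    ≡⟨ cong₂ (λ u v → u + c + v) (C-absorption n k) (C-absorption n (suc k)) ⟩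
  suc n * (n C k) + c + suc n * (n C suc k)
    ≡⟨ collect (suc n) (n C k) (n C suc k) c ⟩
  suc n * ((n C k) + (n C suc k)) + c
    ≡⟨ cong (λ u → suc n * u + c) (nCk+nC[k+1]≡[n+1]C[k+1] n k) ⟩
  suc n * c + c
    ≡⟨ +-comm (suc n * c) c ⟩
  suc (suc n) * c ∎
  where
  open ≡-Reasoning
  c = suc n C suc k
  distrib : ∀ k u v → suc k * (u + v) ≡ k * u + u + suc k * v
  distrib = solve-∀
  collect : ∀ n u v c → n * u + c + n * v ≡ n * (u + v) + c
  collect = solve-∀

nCk≤[1+n]Ck : ∀ n k → n C k ≤ suc n C k
nCk≤[1+n]Ck n zero    = ≤-reflexive (trans (nC0≡1 n) (sym (nC0≡1 (suc n))))
nCk≤[1+n]Ck n (suc k) = subst (n C suc k ≤_) (nCk+nC[k+1]≡[n+1]C[k+1] n k) (m≤n+m _ _)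

C-monoˡ-≤ : ∀ k {m n} → m ≤ n → m C k ≤ n C k
C-monoˡ-≤ k m≤n = go (≤⇒≤′ m≤n)
  where
  go : ∀ {m n} → m ≤′ n → m C k ≤ n C k
  go ≤′-refl       = ≤-refl
  go (≤′-step m≤n) = ≤-trans (go m≤n) (nCk≤[1+n]Ck _ k)

-- After multiplication by `suc k * suc k`, absorption turns each side into a product of two linear
-- factors times the same inequality for `k`. The linear factors compare because their products
-- differ by exactly `b * c`. For `x = 0` and positive lower index the left side vanishes.
C-logConcave : ∀ k x b c → (x C k) * ((x + b + c) C k) ≤ ((x + b) C k) * ((x + c) C k)
C-logConcave zero x b c
  rewrite nC0≡1 x | nC0≡1 (x + b + c) | nC0≡1 (x + b) | nC0≡1 (x + c) = ≤-refl
C-logConcave (suc k) zero    b c rewrite 0C[1+k]≡0 k = z≤n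
C-logConcave (suc k) (suc x) b c = *-cancelˡ-≤ (suc k * suc k) (begin
  suc k * suc k * ((suc x C suc k) * (suc (x + b + c) C suc k))
    ≡⟨ absorb x (x + b + c) ⟩
  suc x * suc (x + b + c) * ((x C k) * ((x + b + c) C k))
    ≤⟨ *-mono-≤ factors (C-logConcave k x b c) ⟩
  suc (x + b) * suc (x + c) * (((x + b) C k) * ((x + c) C k))
    ≡⟨ absorb (x + b) (x + c) ⟨
  suc k * suc k * ((suc (x + b) C suc k) * (suc (x + c) C suc k)) ∎)
  where
  open ≤-Reasoning
  interchange : ∀ p q u v → p * q * (u * v) ≡ p * u * (q * v)
  interchange = solve-∀
  absorb : ∀ m n → suc k * suc k * ((suc m C suc k) * (suc n C suc k))
                 ≡ suc m * suc n * ((m C k) * (n C k))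
  absorb m n = trans (interchange (suc k) (suc k) (suc m C suc k) (suc n C suc k))
    (trans (cong₂ _*_ (C-absorption m k) (C-absorption n k))
           (sym (interchange (suc m) (suc n) (m C k) (n C k))))
  expand : ∀ x b c → suc x * suc (x + b + c) + b * c ≡ suc (x + b) * suc (x + c)
  expand = solve-∀
  factors : suc x * suc (x + b + c) ≤ suc (x + b) * suc (x + c)
  factors = m+n≤o⇒m≤o _ (≤-reflexive (expand x b c))

-- Union bound: z C N times the probability that a random N-subset of z points
-- lies in a given set of y + i points but meets i of them is at most i N / z.
C-unionBound : ∀ N z y i → y + i ≤ z →
  z * ((y + i) C N) ≤ z * (y C N) + i * (N * (z C N))
C-unionBound zero z y i _ rewrite nC0≡1 (y + i) | nC0≡1 y = m≤m+n _ _
C-unionBound (suc N) z y zero y≤z rewrite +-identityʳ y = m≤m+n _ _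
C-unionBound (suc N) (suc z) y (suc i) y+i≤z rewrite +-suc y i = begin
  suc z * (suc (y + i) C suc N)
    ≡⟨ cong (suc z *_) (nCk+nC[k+1]≡[n+1]C[k+1] (y + i) N) ⟨
  suc z * (((y + i) C N) + ((y + i) C suc N))
    ≡⟨ *-distribˡ-+ (suc z) ((y + i) C N) ((y + i) C suc N) ⟩
  suc z * ((y + i) C N) + suc z * ((y + i) C suc N)
    -- One of the `suc i` extra points is singled out. The subsets through it number `(y + i) C N`,
    -- at most `z C N`, and by absorption `suc z * (z C N)` is exactly one unit `t` of the error
    -- term.
    ≤⟨ +-mono-≤ (*-monoʳ-≤ (suc z) (C-monoˡ-≤ N (s≤s⁻¹ y+i≤z)))
                (C-unionBound (suc N) (suc z) y i (<⇒≤ y+i≤z)) ⟩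
  suc z * (z C N) + (suc z * (y C suc N) + i * t)
    ≡⟨ cong (_+ (suc z * (y C suc N) + i * t)) (C-absorption z N) ⟨
  t + (suc z * (y C suc N) + i * t)
    ≡⟨ shuffle t (suc z * (y C suc N)) (i * t) ⟩
  suc z * (y C suc N) + (t + i * t) ∎
  where
  open ≤-Reasoning
  t = suc N * (suc z C suc N)
  shuffle : ∀ p q r → p + (q + r) ≡ q + (p + r)
  shuffle = solve-∀
C-unionBound (suc N) zero y (suc i) y+i≤z = z≤n

-- Two sets F and G cut the `z` points into cells: `x` in neither, `b` only in G, `c` only in F, `i`
-- in both. Log-concavity is applied to the disjoint sets F and G minus F, whose complements have
-- `x + b` and `x + c + i` points. The union bound then replaces G minus F by G, and the other
-- factor is bounded by `t`.
C-covariance : ∀ N x b c i → let z = x + b + c + i; t = z C N in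
  z * (t * (x C N)) ≤ z * (((x + b) C N) * ((x + c) C N)) + i * (N * (t * t))
C-covariance N x b c i = begin
  z * (t * (x C N))
    ≡⟨ cong (z *_) (*-comm t _) ⟩
  z * ((x C N) * t)
    ≡⟨ cong (λ u → z * ((x C N) * (u C N))) (+-assoc (x + b) c i) ⟩
  z * ((x C N) * ((x + b + (c + i)) C N))
    ≤⟨ *-monoʳ-≤ z (C-logConcave N x b (c + i)) ⟩
  z * (p * ((x + (c + i)) C N))
    ≡⟨ cong (λ u → z * (p * (u C N))) (sym (+-assoc x c i)) ⟩
  z * (p * ((x + c + i) C N))
    ≡⟨ swap z p _ ⟩
  p * (z * ((x + c + i) C N))
    ≤⟨ *-monoʳ-≤ p (C-unionBound N z (x + c) i (+-monoˡ-≤ i (+-monoˡ-≤ c (m≤m+n x b)))) ⟩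
  p * (z * q + i * (N * t))
    ≡⟨ *-distribˡ-+ p _ _ ⟩
  p * (z * q) + p * (i * (N * t))
    ≤⟨ +-monoʳ-≤ (p * (z * q)) (*-monoˡ-≤ (i * (N * t)) p≤t) ⟩
  p * (z * q) + t * (i * (N * t))
    ≡⟨ cong₂ _+_ (swap p z q) (rotate t i N) ⟩
  z * (p * q) + i * (N * (t * t)) ∎
  where
  open ≤-Reasoning
  z = x + b + c + i
  t = z C N
  p = (x + b) C N
  q = (x + c) C N
  p≤t : p ≤ t
  p≤t = C-monoˡ-≤ N (≤-trans (m≤m+n (x + b) c) (m≤m+n (x + b + c) i))
  swap : ∀ u v w → u * (v * w) ≡ v * (u * w)
  swap = solve-∀
  rotate : ∀ t i N → t * (i * (N * t)) ≡ i * (N * (t * t))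
  rotate = solve-∀

-- Finite sums and indicators.

∑ : List X → (X → ℕ) → ℕ
∑ xs f = sum (map f xs)

∑-cong : ∀ (xs : List X) {f g} → (∀ x → f x ≡ g x) → ∑ xs f ≡ ∑ xs g
∑-cong []       f≗g = refl
∑-cong (x ∷ xs) f≗g = cong₂ _+_ (f≗g x) (∑-cong xs f≗g)

∑-mono-≤ : ∀ (xs : List X) {f g} → (∀ x → f x ≤ g x) → ∑ xs f ≤ ∑ xs g
∑-mono-≤ []       f≤g = z≤n
∑-mono-≤ (x ∷ xs) f≤g = +-mono-≤ (f≤g x) (∑-mono-≤ xs f≤g)

∑-const : ∀ (xs : List X) c → ∑ xs (const c) ≡ length xs * c
∑-const []       c = refl
∑-const (x ∷ xs) c = cong (c +_) (∑-const xs c)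

∑-distrib-+ : ∀ (xs : List X) f g → ∑ xs (λ x → f x + g x) ≡ ∑ xs f + ∑ xs g
∑-distrib-+ []       f g = refl
∑-distrib-+ (x ∷ xs) f g rewrite ∑-distrib-+ xs f g = shuffle (f x) (g x) _ _
  where
  shuffle : ∀ p q u v → p + q + (u + v) ≡ p + u + (q + v)
  shuffle = solve-∀

*-distribˡ-∑ : ∀ c (xs : List X) f → c * ∑ xs f ≡ ∑ xs (λ x → c * f x)
*-distribˡ-∑ c []       f = *-zeroʳ c
*-distribˡ-∑ c (x ∷ xs) f = trans (*-distribˡ-+ c (f x) _) (cong (c * f x +_) (*-distribˡ-∑ c xs f))

∑*∑ : ∀ (xs : List X) (ys : List Y) f g → ∑ xs f * ∑ ys g ≡ ∑ xs (λ x → ∑ ys (λ y → f x * g y))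
∑*∑ []       ys f g = refl
∑*∑ (x ∷ xs) ys f g = trans (*-distribʳ-+ (∑ ys g) (f x) _)
  (cong₂ _+_ (*-distribˡ-∑ (f x) ys g) (∑*∑ xs ys f g))

∑-swap : ∀ (xs : List X) (ys : List Y) (f : X → Y → ℕ) →
  ∑ xs (λ x → ∑ ys (f x)) ≡ ∑ ys (λ y → ∑ xs (λ x → f x y))
∑-swap []       ys f = sym (trans (∑-const ys 0) (*-zeroʳ (length ys)))
∑-swap (x ∷ xs) ys f = trans (cong (∑ ys (f x) +_) (∑-swap xs ys f))
  (sym (∑-distrib-+ ys (f x) _))

[_] : Bool → ℕ
[ false ] = 0
[ true  ] = 1

[]-∧ : ∀ b c → [ b ∧ c ] ≡ [ b ] * [ c ]
[]-∧ false c = refl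
[]-∧ true  c = sym (+-identityʳ [ c ])

length-filter≡∑ : ∀ {P : Pred X 0ℓ} (P? : Decidable P) xs →
  length (filter P? xs) ≡ ∑ xs (λ x → [ does (P? x) ])
length-filter≡∑ P? []       = refl
length-filter≡∑ P? (x ∷ xs) with does (P? x)
... | true  = cong suc (length-filter≡∑ P? xs)
... | false = length-filter≡∑ P? xs

all-∧ : ∀ (f g : X → Bool) xs → all f xs ∧ all g xs ≡ all (λ x → f x ∧ g x) xs
all-∧ f g []       = refl
all-∧ f g (x ∷ xs) rewrite sym (all-∧ f g xs) with f x | g x
... | true  | true  = refl
... | true  | false with all f xs
...   | true  = refl
...   | false = refl
all-∧ f g (x ∷ xs) | false | _ = refl

-- Counting the `N`-element sublists that avoid given sets.

∑-choose-∷ : ∀ N x (xs : List X) (f : List X → ℕ) →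
  ∑ (choose (suc N) (x ∷ xs)) f ≡ ∑ (choose N xs) (f ∘ (x ∷_)) + ∑ (choose (suc N) xs) f
∑-choose-∷ N x xs f = begin
  sum (map f (map (x ∷_) (choose N xs) ++ choose (suc N) xs))
    ≡⟨ cong sum (map-++ f (map (x ∷_) (choose N xs)) _) ⟩
  sum (map f (map (x ∷_) (choose N xs)) ++ map f (choose (suc N) xs))
    ≡⟨ sum-++ (map f (map (x ∷_) (choose N xs))) _ ⟩
  sum (map f (map (x ∷_) (choose N xs))) + ∑ (choose (suc N) xs) f
    ≡⟨ cong (λ l → sum l + ∑ (choose (suc N) xs) f) (map-∘ (choose N xs)) ⟨
  ∑ (choose N xs) (f ∘ (x ∷_)) + ∑ (choose (suc N) xs) f ∎
  where open ≡-Reasoning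

-- The sublists counted are those drawn entirely from the entries that pass `g`. A passing head
-- makes the recursion of `choose` into Pascal's rule; a failing head contributes only zeros. This
-- is where sums over placements become binomial coefficients.
∑-choose-all : ∀ N (g : X → Bool) xs →
  ∑ (choose N xs) (λ ω → [ all g ω ]) ≡ ∑ xs (λ x → [ g x ]) C N
∑-choose-all zero    g xs = sym (nC0≡1 (∑ xs (λ x → [ g x ])))
∑-choose-all (suc N) g [] = sym (0C[1+k]≡0 N)
∑-choose-all (suc N) g (x ∷ xs)
  rewrite ∑-choose-∷ N x xs (λ ω → [ all g ω ]) | ∑-choose-all (suc N) g xs with g x
... | true rewrite ∑-choose-all N g xs = nCk+nC[k+1]≡[n+1]C[k+1] (∑ xs (λ x → [ g x ])) N
... | false rewrite ∑-const (choose N xs) 0 | *-zeroʳ (length (choose N xs)) = refl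

length≡∑1 : ∀ (xs : List X) → length xs ≡ ∑ xs (const 1)
length≡∑1 xs = trans (sym (*-identityʳ _)) (sym (∑-const xs 1))

length-choose : ∀ N (xs : List X) → length (choose N xs) ≡ length xs C N
length-choose N xs = begin
  length (choose N xs)                              ≡⟨ length≡∑1 (choose N xs) ⟩
  ∑ (choose N xs) (const 1)                         ≡⟨ ∑-cong (choose N xs) (cong [_] ∘ all-true) ⟨
  ∑ (choose N xs) (λ ω → [ all (const true) ω ])    ≡⟨ ∑-choose-all N (const true) xs ⟩
  ∑ xs (const 1) C N                                ≡⟨ cong (_C N) (length≡∑1 xs) ⟨
  length xs C N                                     ∎
  where
  open ≡-Reasoning
  all-true : ∀ (ω : List _) → all (const true) ω ≡ true
  all-true []      = refl
  all-true (_ ∷ ω) = all-true ω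

∑-partition : ∀ (xs : List X) (f g : X → Bool) → ∑ xs (λ x → [ f x ]) ≡
  ∑ xs (λ x → [ f x ∧ g x ]) + ∑ xs (λ x → [ f x ∧ not (g x) ])
∑-partition xs f g = trans (∑-cong xs (λ x → split (f x) (g x)))
  (∑-distrib-+ xs (λ x → [ f x ∧ g x ]) (λ x → [ f x ∧ not (g x) ]))
  where
  split : ∀ b c → [ b ] ≡ [ b ∧ c ] + [ b ∧ not c ]
  split true  true  = refl
  split true  false = refl
  split false _     = refl

-- Here `f` and `g` mark the positions that hit two given targets, and the cells of `C-covariance`
-- become indicator sums over `xs`.
covariance-bound : ∀ N (xs : List X) (f g : X → Bool) →
  let z = length xs; t = z C N in
  z * (t * (∑ xs (λ x → [ not (f x) ∧ not (g x) ]) C N)) ≤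
  z * ((∑ xs (λ x → [ not (f x) ]) C N) * (∑ xs (λ x → [ not (g x) ]) C N))
    + ∑ xs (λ x → [ f x ∧ g x ]) * (N * (t * t))
covariance-bound {X} N xs f g = subst-bound (C-covariance N x b c i)
  where
  f′ g′ : X → Bool
  f′ = not ∘ f
  g′ = not ∘ g
  x b c i : ℕ
  x = ∑ xs (λ p → [ f′ p ∧ g′ p ])
  b = ∑ xs (λ p → [ f′ p ∧ g p ])
  c = ∑ xs (λ p → [ f p ∧ g′ p ])
  i = ∑ xs (λ p → [ f p ∧ g p ])
  ∑f′ : ∑ xs (λ p → [ f′ p ]) ≡ x + b
  ∑f′ = trans (∑-partition xs f′ g) (+-comm b x)
  ∑g′ : ∑ xs (λ p → [ g′ p ]) ≡ x + c
  ∑g′ = trans (∑-cong xs λ p → split (f p) (g p)) (∑-distrib-+ xs (λ p → [ f′ p ∧ g′ p ]) (λ p → [ f p ∧ g′ p ]))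
    where
    split : ∀ b c → [ not c ] ≡ [ not b ∧ not c ] + [ b ∧ not c ]
    split true  _ = refl
    split false c = sym (+-identityʳ [ not c ])
  z≡ : length xs ≡ x + b + c + i
  z≡ = begin
    length xs                       ≡⟨ length≡∑1 xs ⟩
    ∑ xs (const 1)                  ≡⟨ ∑-cong xs (λ p → split (f p)) ⟩
    ∑ xs (λ p → [ f′ p ] + [ f p ]) ≡⟨ ∑-distrib-+ xs (λ p → [ f′ p ]) (λ p → [ f p ]) ⟩
    ∑ xs (λ p → [ f′ p ]) + ∑ xs (λ p → [ f p ]) ≡⟨ cong₂ _+_ ∑f′ (∑-partition xs f g) ⟩
    x + b + (i + c)                 ≡⟨ shuffle x b c i ⟩
    x + b + c + i ∎
    where
    open ≡-Reasoning
    split : ∀ b → 1 ≡ [ not b ] + [ b ]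
    split true  = refl
    split false = refl
    shuffle : ∀ x b c i → x + b + (i + c) ≡ x + b + c + i
    shuffle = solve-∀
  -- The three totals are made parameters, with the cells `x` and `i` held fixed, so that the
  -- inequality can be transported along the partition identities in one go.
  Bound : ℕ → ℕ → ℕ → Set
  Bound z u v = z * ((z C N) * (x C N)) ≤ z * ((u C N) * (v C N)) + i * (N * ((z C N) * (z C N)))
  subst-bound : Bound (x + b + c + i) (x + b) (x + c) →
                Bound (length xs) (∑ xs (λ p → [ f′ p ])) (∑ xs (λ p → [ g′ p ]))
  subst-bound rewrite ∑f′ | ∑g′ | z≡ = id

-- First and second moments of the number of unhit targets.

module _ (r : X → Y → Bool) (xs : List X) (ys : List Y) where

  -- With `r` the attack relation and both lists the whole board, this is the number of safe spaces.
  unhit : List X → ℕ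
  unhit ω = ∑ ys (λ q → [ all (λ p → not (r p q)) ω ])

  ∑-unhit : ∀ N → ∑ (choose N xs) unhit ≡ ∑ ys (λ q → ∑ xs (λ p → [ not (r p q) ]) C N)
  ∑-unhit N = trans (∑-swap (choose N xs) ys _) (∑-cong ys λ q → ∑-choose-all N _ xs)

  -- The square of a sum of indicators is a sum over pairs of targets, and a pair is unhit jointly
  -- exactly when each piece misses both, which is again a condition of the form handled by
  -- `∑-choose-all`.
  ∑-unhit² : ∀ N → ∑ (choose N xs) (λ ω → unhit ω * unhit ω) ≡
    ∑ ys (λ q → ∑ ys (λ q′ → ∑ xs (λ p → [ not (r p q) ∧ not (r p q′) ]) C N))
  ∑-unhit² N = begin
    ∑ (choose N xs) (λ ω → unhit ω * unhit ω)
      ≡⟨ ∑-cong (choose N xs) (λ ω → ∑*∑ ys ys _ _) ⟩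
    ∑ (choose N xs) (λ ω → ∑ ys (λ q → ∑ ys (λ q′ → [ s ω q ] * [ s ω q′ ])))
      ≡⟨ ∑-swap (choose N xs) ys _ ⟩
    ∑ ys (λ q → ∑ (choose N xs) (λ ω → ∑ ys (λ q′ → [ s ω q ] * [ s ω q′ ])))
      ≡⟨ ∑-cong ys (λ q → ∑-swap (choose N xs) ys _) ⟩
    ∑ ys (λ q → ∑ ys (λ q′ → ∑ (choose N xs) (λ ω → [ s ω q ] * [ s ω q′ ])))
      ≡⟨ ∑-cong ys (λ q → ∑-cong ys λ q′ → ∑-cong (choose N xs) λ ω →
           trans (sym ([]-∧ (s ω q) (s ω q′))) (cong [_] (all-∧ _ _ ω))) ⟩
    ∑ ys (λ q → ∑ ys (λ q′ → ∑ (choose N xs) (λ ω → [ all (λ p → not (r p q) ∧ not (r p q′)) ω ])))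
      ≡⟨ ∑-cong ys (λ q → ∑-cong ys λ q′ → ∑-choose-all N _ xs) ⟩
    ∑ ys (λ q → ∑ ys (λ q′ → ∑ xs (λ p → [ not (r p q) ∧ not (r p q′) ]) C N)) ∎
    where
    open ≡-Reasoning
    s : List X → Y → Bool
    s ω q = all (λ p → not (r p q)) ω

  -- Double counting: both sides count triples (p, q, q′) with p related to q and q′.
  ∑-common≡∑-degree² :
    ∑ ys (λ q → ∑ ys (λ q′ → ∑ xs (λ p → [ r p q ∧ r p q′ ]))) ≡
    ∑ xs (λ p → ∑ ys (λ q → [ r p q ]) * ∑ ys (λ q → [ r p q ]))
  ∑-common≡∑-degree² = begin
    ∑ ys (λ q → ∑ ys (λ q′ → ∑ xs (λ p → [ r p q ∧ r p q′ ])))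
      ≡⟨ ∑-cong ys (λ q → ∑-swap ys xs _) ⟩
    ∑ ys (λ q → ∑ xs (λ p → ∑ ys (λ q′ → [ r p q ∧ r p q′ ])))
      ≡⟨ ∑-swap ys xs _ ⟩
    ∑ xs (λ p → ∑ ys (λ q → ∑ ys (λ q′ → [ r p q ∧ r p q′ ])))
      ≡⟨ ∑-cong xs (λ p → ∑-cong ys λ q → ∑-cong ys λ q′ → []-∧ (r p q) (r p q′)) ⟩
    ∑ xs (λ p → ∑ ys (λ q → ∑ ys (λ q′ → [ r p q ] * [ r p q′ ])))
      ≡⟨ ∑-cong xs (λ p → ∑*∑ ys ys _ _) ⟨
    ∑ xs (λ p → ∑ ys (λ q → [ r p q ]) * ∑ ys (λ q → [ r p q ])) ∎
    where open ≡-Reasoning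

  -- This is the variance bound `N * (D * D)` with denominators cleared: `t * ∑ unhit²` minus
  -- `s₁ * s₁` is `t * t` times the variance. The covariance bounds are summed over all pairs of
  -- targets.
  unhit-secondMoment : ∀ N D .{{_ : NonZero (length xs)}} →
    (∀ p → ∑ ys (λ q → [ r p q ]) ≤ D) →
    let t = length (choose N xs); s₁ = ∑ (choose N xs) unhit in
    t * ∑ (choose N xs) (λ ω → unhit ω * unhit ω) ≤ s₁ * s₁ + t * t * (N * (D * D))
  unhit-secondMoment N D deg≤D rewrite length-choose N xs | ∑-unhit N | ∑-unhit² N =
    -- The covariance bound carries a denominator `z`, so everything is scaled by `z`; double
    -- counting bounds the total overlap by `z * (D * D)`, which restores a factor `z` to cancel.
    *-cancelˡ-≤ z (begin
      z * (t * ∑ ys (λ q → ∑ ys (both q)))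
        ≡⟨ cong (z *_) (push t both) ⟩
      z * ∑ ys (λ q → ∑ ys (λ q′ → t * both q q′))
        ≡⟨ push z _ ⟩
      ∑ ys (λ q → ∑ ys (λ q′ → z * (t * both q q′)))
        ≤⟨ ∑-mono-≤ ys (λ q → ∑-mono-≤ ys λ q′ → covariance-bound N xs _ _) ⟩
      ∑ ys (λ q → ∑ ys (λ q′ → z * (one q * one q′) + common q q′ * w))
        ≡⟨ ∑-cong ys (λ q → ∑-distrib-+ ys _ _) ⟩
      ∑ ys (λ q → ∑ ys (λ q′ → z * (one q * one q′)) + ∑ ys (λ q′ → common q q′ * w))
        ≡⟨ ∑-distrib-+ ys _ _ ⟩
      ∑ ys (λ q → ∑ ys (λ q′ → z * (one q * one q′))) + ∑ ys (λ q → ∑ ys (λ q′ → common q q′ * w))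
        ≡⟨ cong₂ _+_
             (trans (sym (push z (λ q q′ → one q * one q′))) (cong (z *_) (sym (∑*∑ ys ys one one))))
             (trans (∑-cong ys λ q → ∑-cong ys λ q′ → *-comm (common q q′) w) (sym (push w common))) ⟩
      z * (∑ ys one * ∑ ys one) + w * ∑ ys (λ q → ∑ ys (common q))
        ≡⟨ cong (λ u → z * (∑ ys one * ∑ ys one) + w * u) ∑-common≡∑-degree² ⟩
      z * (∑ ys one * ∑ ys one) + w * ∑ xs (λ p → ∑ ys (λ q → [ r p q ]) * ∑ ys (λ q → [ r p q ]))
        ≤⟨ +-monoʳ-≤ (z * (∑ ys one * ∑ ys one)) (*-monoʳ-≤ w
             (∑-mono-≤ xs λ p → *-mono-≤ (deg≤D p) (deg≤D p))) ⟩
      z * (∑ ys one * ∑ ys one) + w * ∑ xs (const (D * D))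
        ≡⟨ cong (λ u → z * (∑ ys one * ∑ ys one) + w * u) (∑-const xs (D * D)) ⟩
      z * (∑ ys one * ∑ ys one) + w * (z * (D * D))
        ≡⟨ factor z (∑ ys one * ∑ ys one) N t (D * D) ⟩
      z * (∑ ys one * ∑ ys one + t * t * (N * (D * D))) ∎)
    where
    open ≤-Reasoning
    z = length xs
    t = z C N
    w = N * (t * t)
    one : Y → ℕ
    one q = ∑ xs (λ p → [ not (r p q) ]) C N
    both common : Y → Y → ℕ
    both q q′   = ∑ xs (λ p → [ not (r p q) ∧ not (r p q′) ]) C N
    common q q′ = ∑ xs (λ p → [ r p q ∧ r p q′ ])
    push : ∀ c (f : Y → Y → ℕ) → c * ∑ ys (λ q → ∑ ys (f q)) ≡ ∑ ys (λ q → ∑ ys (λ q′ → c * f q q′))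
    push c f = trans (*-distribˡ-∑ c ys _) (∑-cong ys λ q → *-distribˡ-∑ c ys (f q))
    factor : ∀ z s N t e → z * s + N * (t * t) * (z * e) ≡ z * (s + t * t * (N * e))
    factor = solve-∀

-- Pieces that attack everything.

∑-choose-suc≡0 : ∀ N (xs : List X) {f : List X → ℕ} → (∀ x ω → f (x ∷ ω) ≡ 0) →
  ∑ (choose (suc N) xs) f ≡ 0
∑-choose-suc≡0 N []       f≡0 = refl
∑-choose-suc≡0 N (x ∷ xs) {f} f≡0 = begin
  ∑ (choose (suc N) (x ∷ xs)) f
    ≡⟨ ∑-choose-∷ N x xs f ⟩
  ∑ (choose N xs) (f ∘ (x ∷_)) + ∑ (choose (suc N) xs) f
    ≡⟨ cong₂ _+_ (∑-cong (choose N xs) (f≡0 x)) (∑-choose-suc≡0 N xs f≡0) ⟩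
  ∑ (choose N xs) (const 0) + 0
    ≡⟨ cong (_+ 0) (trans (∑-const (choose N xs) 0) (*-zeroʳ (length (choose N xs)))) ⟩
  0 ∎
  where open ≡-Reasoning

-- The piece `p` alone hits as many targets as there are, so the complementary count is zero; the
-- conditions imposed by `ω` can only lower the number of unhit targets.
unhit-∷≡0 : ∀ (r : X → Y → Bool) xs ys p ω → length ys ≤ ∑ ys (λ q → [ r p q ]) →
  unhit r xs ys (p ∷ ω) ≡ 0
unhit-∷≡0 r xs ys p ω full = n≤0⇒n≡0 (≤-trans
  (∑-mono-≤ ys λ q → [∧]≤ (not (r p q)) _)
  (+-cancelˡ-≤ (∑ ys (λ q → [ r p q ])) _ 0 (begin
    ∑ ys (λ q → [ r p q ]) + ∑ ys (λ q → [ not (r p q) ]) ≡⟨ ∑-partition ys (const true) (r p) ⟨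
    ∑ ys (const 1)                                        ≡⟨ length≡∑1 ys ⟨
    length ys                                             ≤⟨ full ⟩
    ∑ ys (λ q → [ r p q ])                                ≡⟨ +-identityʳ _ ⟨
    ∑ ys (λ q → [ r p q ]) + 0                            ∎)))
  where
  open ≤-Reasoning
  [∧]≤ : ∀ b c → [ b ∧ c ] ≤ [ b ]
  [∧]≤ false c     = z≤n
  [∧]≤ true  false = z≤n
  [∧]≤ true  true  = ≤-refl

-- The board: its size, and attack and safe counts as indicator sums.

length-cartesianProductWith : ∀ {Z : Set} (f : X → Y → Z) xs ys →
  length (cartesianProductWith f xs ys) ≡ length xs * length ys
length-cartesianProductWith f []       ys = refl
length-cartesianProductWith f (x ∷ xs) ys = trans (length-++ (map (f x) ys))
  (cong₂ _+_ (length-map (f x) ys) (length-cartesianProductWith f xs ys))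

length-spaces : ∀ k n → length (spaces k n) ≡ n ^ k
length-spaces zero    n = refl
length-spaces (suc k) n = trans (length-cartesianProductWith Vec._∷_ (allFin n) (spaces k n))
  (cong₂ _*_ (length-tabulate {n = n} id) (length-spaces k n))

module _ {k n : ℕ} (R : AttackRule k n) where

  attacksᵇ : Space k n → Space k n → Bool
  attacksᵇ p q = does (_attacks?_ R p q)

  attackCount≡∑ : ∀ p → attackCount R p ≡ ∑ (spaces k n) (λ q → [ attacksᵇ p q ])
  attackCount≡∑ p = length-filter≡∑ (_attacks?_ R p) (spaces k n)

  safeCount≡unhit : ∀ ω → safeCount R ω ≡ unhit attacksᵇ (spaces k n) (spaces k n) ω
  safeCount≡unhit ω = trans (length-filter≡∑ (safe? R ω) (spaces k n))
    (∑-cong (spaces k n) λ q → cong [_] (does-all? q ω))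
    where
    does-all? : ∀ q ω → does (safe? R ω q) ≡ all (λ p → not (attacksᵇ p q)) ω
    does-all? q []      = refl
    does-all? q (p ∷ ω) = cong (not (attacksᵇ p q) ∧_) (does-all? q ω)

-- Embedding natural numbers into the rationals.

ι : ℕ → ℚ
ι n = fromℤ (ℤ.+ n)

ι-+ : ∀ m n → ι (m + n) ≡ ι m ℚ.+ ι n
ι-+ m n = ℚ.toℚᵘ-injective (ℚᵘ.≃-trans
  (ℚᵘ.*≡* (cong (ℤ._* ℤ.1ℤ) (sym (cong₂ ℤ._+_ (ℤ.*-identityʳ (ℤ.+ m)) (ℤ.*-identityʳ (ℤ.+ n))))))
  (ℚᵘ.≃-sym (ℚ.toℚᵘ-homo-+ (ι m) (ι n))))

ι-* : ∀ m n → ι (m * n) ≡ ι m ℚ.* ι n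
ι-* m n = ℚ.toℚᵘ-injective (ℚᵘ.≃-trans
  (ℚᵘ.*≡* (cong (ℤ._* ℤ.1ℤ) (ℤ.pos-* m n)))
  (ℚᵘ.≃-sym (ℚ.toℚᵘ-homo-* (ι m) (ι n))))

ι-mono-≤ : ∀ {m n} → m ≤ n → ι m ℚ.≤ ι n
ι-mono-≤ m≤n = ℚ.*≤* (ℤ.*-monoʳ-≤-nonNeg ℤ.1ℤ (ℤ.+≤+ m≤n))

ι-mono-< : ∀ {m n} → m < n → ι m ℚ.< ι n
ι-mono-< m<n = ℚ.*<* (ℤ.*-monoʳ-<-pos ℤ.1ℤ (ℤ.+<+ m<n))

-- Splitting off the reciprocal gives all proportions on one board a common weight, which can then
-- be pulled out of sums.
/≡ι*1/ : ∀ s n .{{_ : NonZero n}} → (ℤ.+ s) ℚ./ n ≡ ι s ℚ.* ((ℤ.+ 1) ℚ./ n)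
/≡ι*1/ s n@(suc n′) = ℚ.toℚᵘ-injective (begin
  toℚᵘ (ℤ.+ s ℚ./ n)                        ≈⟨ ℚ.toℚᵘ-fromℚᵘ (ℚᵘ.mkℚᵘ (ℤ.+ s) n′) ⟩
  ℚᵘ.mkℚᵘ (ℤ.+ s) n′                        ≈⟨ ℚᵘ.*≡* (cong₂ ℤ._*_ (ℤ.*-identityʳ (ℤ.+ s)) (cong ℤ.+_ (sym (+-identityʳ n)))) ⟨
  toℚᵘ (ι s) ℚᵘ.* ℚᵘ.mkℚᵘ (ℤ.+ 1) n′        ≈⟨ ℚᵘ.*-congˡ {toℚᵘ (ι s)} (ℚ.toℚᵘ-fromℚᵘ (ℚᵘ.mkℚᵘ (ℤ.+ 1) n′)) ⟨
  toℚᵘ (ι s) ℚᵘ.* toℚᵘ (ℤ.+ 1 ℚ./ n)        ≈⟨ ℚ.toℚᵘ-homo-* (ι s) (ℤ.+ 1 ℚ./ n) ⟨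
  toℚᵘ (ι s ℚ.* (ℤ.+ 1 ℚ./ n))              ∎)
  where open import Relation.Binary.Reasoning.Setoid ℚᵘ.≃-setoid

n/n≡1ℚ : ∀ n .{{_ : NonZero n}} → (ℤ.+ n) ℚ./ n ≡ 1ℚ
n/n≡1ℚ n@(suc n′) = ℚ.toℚᵘ-injective (ℚᵘ.≃-trans (ℚ.toℚᵘ-fromℚᵘ (ℚᵘ.mkℚᵘ (ℤ.+ n) n′))
  (ℚᵘ.*≡* (ℤ.*-comm (ℤ.+ n) ℤ.1ℤ)))

ιn*1/n≡1 : ∀ n .{{_ : NonZero n}} → ι n ℚ.* ((ℤ.+ 1) ℚ./ n) ≡ 1ℚ
ιn*1/n≡1 n = trans (sym (/≡ι*1/ n n)) (n/n≡1ℚ n)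

0≤p*p : ∀ p → 0ℚ ℚ.≤ p ℚ.* p
0≤p*p p@(mkℚ (ℤ.+ _) _ _)    = ℚ.nonNegative⁻¹ (p ℚ.* p) {{ℚ.nonNeg*nonNeg⇒nonNeg p p}}
0≤p*p p@(mkℚ ℤ.-[1+ _ ] _ _) = ℚ.<⇒≤ (ℚ.positive⁻¹ (p ℚ.* p) {{ℚ.neg*neg⇒pos p p}})

-- Variance over a finite list.

sumℚ-nonNeg : ∀ (Ω : List X) (f : X → ℚ) → (∀ ω → 0ℚ ℚ.≤ f ω) → 0ℚ ℚ.≤ sumℚ (map f Ω)
sumℚ-nonNeg []      f 0≤f = ℚ.≤-refl
sumℚ-nonNeg (ω ∷ Ω) f 0≤f = ℚ.+-mono-≤ (0≤f ω) (sumℚ-nonNeg Ω f 0≤f)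

sumℚ-ι* : ∀ (Ω : List X) (s : X → ℕ) w (f : X → ℚ) → (∀ ω → f ω ≡ ι (s ω) ℚ.* w) →
  sumℚ (map f Ω) ≡ ι (∑ Ω s) ℚ.* w
sumℚ-ι* []      s w f f≡ = sym (ℚ.*-zeroˡ w)
sumℚ-ι* (ω ∷ Ω) s w f f≡ = begin
  f ω ℚ.+ sumℚ (map f Ω)               ≡⟨ cong₂ ℚ._+_ (f≡ ω) (sumℚ-ι* Ω s w f f≡) ⟩
  ι (s ω) ℚ.* w ℚ.+ ι (∑ Ω s) ℚ.* w    ≡⟨ ℚ.*-distribʳ-+ w (ι (s ω)) (ι (∑ Ω s)) ⟨
  (ι (s ω) ℚ.+ ι (∑ Ω s)) ℚ.* w        ≡⟨ cong (ℚ._* w) (ι-+ (s ω) (∑ Ω s)) ⟨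
  ι (s ω + ∑ Ω s) ℚ.* w                ∎
  where open ≡-Reasoning

-- The centre `μ` is arbitrary because the induction shortens `Ω`, while the mean to be substituted
-- later is that of the full list.
sumℚ-deviation² : ∀ (Ω : List X) (f : X → ℚ) μ →
  sumℚ (map (λ ω → (f ω ℚ.- μ) ℚ.* (f ω ℚ.- μ)) Ω) ≡
  sumℚ (map (λ ω → f ω ℚ.* f ω) Ω) ℚ.- (sumℚ (map f Ω) ℚ.* μ ℚ.+ sumℚ (map f Ω) ℚ.* μ)
    ℚ.+ ι (length Ω) ℚ.* (μ ℚ.* μ)
sumℚ-deviation² [] f μ = solve 1 (λ μ → con 0ℚ := con 0ℚ :- (con 0ℚ :* μ :+ con 0ℚ :* μ) :+ con 0ℚ :* (μ :* μ)) refl μ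
  where open +-*-Solver
sumℚ-deviation² (ω ∷ Ω) f μ = begin
  (f ω ℚ.- μ) ℚ.* (f ω ℚ.- μ) ℚ.+ sumℚ (map (λ ω → (f ω ℚ.- μ) ℚ.* (f ω ℚ.- μ)) Ω)
    ≡⟨ cong ((f ω ℚ.- μ) ℚ.* (f ω ℚ.- μ) ℚ.+_) (sumℚ-deviation² Ω f μ) ⟩
  (f ω ℚ.- μ) ℚ.* (f ω ℚ.- μ) ℚ.+ (B ℚ.- (A ℚ.* μ ℚ.+ A ℚ.* μ) ℚ.+ ι (length Ω) ℚ.* (μ ℚ.* μ))
    ≡⟨ step (f ω) μ A B (ι (length Ω)) ⟩
  f ω ℚ.* f ω ℚ.+ B ℚ.- ((f ω ℚ.+ A) ℚ.* μ ℚ.+ (f ω ℚ.+ A) ℚ.* μ) ℚ.+ (1ℚ ℚ.+ ι (length Ω)) ℚ.* (μ ℚ.* μ)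
    ≡⟨ cong (λ t → f ω ℚ.* f ω ℚ.+ B ℚ.- ((f ω ℚ.+ A) ℚ.* μ ℚ.+ (f ω ℚ.+ A) ℚ.* μ) ℚ.+ t ℚ.* (μ ℚ.* μ)) (ι-+ 1 (length Ω)) ⟨
  f ω ℚ.* f ω ℚ.+ B ℚ.- ((f ω ℚ.+ A) ℚ.* μ ℚ.+ (f ω ℚ.+ A) ℚ.* μ) ℚ.+ ι (suc (length Ω)) ℚ.* (μ ℚ.* μ) ∎
  where
  open ≡-Reasoning
  A = sumℚ (map f Ω)
  B = sumℚ (map (λ ω → f ω ℚ.* f ω) Ω)
  step : ∀ x μ A B t →
    (x ℚ.- μ) ℚ.* (x ℚ.- μ) ℚ.+ (B ℚ.- (A ℚ.* μ ℚ.+ A ℚ.* μ) ℚ.+ t ℚ.* (μ ℚ.* μ)) ≡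
    x ℚ.* x ℚ.+ B ℚ.- ((x ℚ.+ A) ℚ.* μ ℚ.+ (x ℚ.+ A) ℚ.* μ) ℚ.+ (1ℚ ℚ.+ t) ℚ.* (μ ℚ.* μ)
  step = solve 5 (λ x μ A B t →
    (x :- μ) :* (x :- μ) :+ (B :- (A :* μ :+ A :* μ) :+ t :* (μ :* μ)) :=
    x :* x :+ B :- ((x :+ A) :* μ :+ (x :+ A) :* μ) :+ (con 1ℚ :+ t) :* (μ :* μ)) refl
    where open +-*-Solver

Var-nonNeg : ∀ (Ω : List X) f → 0ℚ ℚ.≤ Var Ω f
Var-nonNeg []          f = ℚ.≤-refl
Var-nonNeg Ω@(_ ∷ Ω′) f = subst (ℚ._≤ Var Ω f) (ℚ.*-zeroˡ c)
  (ℚ.*-monoʳ-≤-nonNeg c (sumℚ-nonNeg Ω _ (λ ω → 0≤p*p (f ω ℚ.- 𝔼 Ω f))))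
  where
  c = ℤ.+ 1 ℚ./ suc (length Ω′)
  instance
    c≥0 : ℚ.NonNegative c
    c≥0 = ℚ.normalize-nonNeg 1 (suc (length Ω′))

-- The last hypothesis is the mean of the square bounded by the squared mean plus `β`, scaled by
-- `t * t`. For empty `Ω` the variance is `0ℚ` by convention, and nonnegativity of `β` settles that
-- case.
Var-≤ : ∀ (Ω : List X) (f : X → ℚ) β → 0ℚ ℚ.≤ β →
  let t = ι (length Ω); A = sumℚ (map f Ω) in
  t ℚ.* sumℚ (map (λ ω → f ω ℚ.* f ω) Ω) ℚ.≤ A ℚ.* A ℚ.+ t ℚ.* t ℚ.* β →
  Var Ω f ℚ.≤ β
Var-≤ []          f β 0≤β _     = 0≤β
Var-≤ Ω@(_ ∷ Ω′) f β _   bound = begin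
  sumℚ (map (λ ω → (f ω ℚ.- A ℚ.* c) ℚ.* (f ω ℚ.- A ℚ.* c)) Ω) ℚ.* c
    ≡⟨ cong (ℚ._* c) (sumℚ-deviation² Ω f (A ℚ.* c)) ⟩
  (B ℚ.- (A ℚ.* (A ℚ.* c) ℚ.+ A ℚ.* (A ℚ.* c)) ℚ.+ t ℚ.* (A ℚ.* c ℚ.* (A ℚ.* c))) ℚ.* c
    ≡⟨ expand A B c t ⟩
  B ℚ.* c ℚ.- A²c² ℚ.- A²c² ℚ.+ t ℚ.* c ℚ.* A²c²
    ≡⟨ cong (λ u → B ℚ.* c ℚ.- A²c² ℚ.- A²c² ℚ.+ u ℚ.* A²c²) tc≡1 ⟩
  B ℚ.* c ℚ.- A²c² ℚ.- A²c² ℚ.+ 1ℚ ℚ.* A²c²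
    ≡⟨ collapse (B ℚ.* c) A²c² ⟩
  1ℚ ℚ.* (B ℚ.* c) ℚ.- A²c²
    -- The unit is turned back into `t * c`, so that `c * c` factors out and the hypothesis applies
    -- to `t * B`.
    ≡⟨ cong (λ u → u ℚ.* (B ℚ.* c) ℚ.- A²c²) tc≡1 ⟨
  t ℚ.* c ℚ.* (B ℚ.* c) ℚ.- A²c²
    ≡⟨ factor A B c t ⟩
  (t ℚ.* B ℚ.- A ℚ.* A) ℚ.* (c ℚ.* c)
    ≤⟨ ℚ.*-monoʳ-≤-nonNeg (c ℚ.* c) {{ℚ.nonNegative (0≤p*p c)}} (ℚ.+-monoˡ-≤ (ℚ.- (A ℚ.* A)) bound) ⟩
  (A ℚ.* A ℚ.+ t ℚ.* t ℚ.* β ℚ.- A ℚ.* A) ℚ.* (c ℚ.* c)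
    ≡⟨ cancel A c t β ⟩
  t ℚ.* c ℚ.* (t ℚ.* c) ℚ.* β
    ≡⟨ cong (λ u → u ℚ.* u ℚ.* β) tc≡1 ⟩
  1ℚ ℚ.* 1ℚ ℚ.* β
    ≡⟨ ℚ.*-identityˡ β ⟩
  β ∎
  where
  open ℚ.≤-Reasoning
  t = ι (length Ω)
  c = ℤ.+ 1 ℚ./ suc (length Ω′)
  A = sumℚ (map f Ω)
  B = sumℚ (map (λ ω → f ω ℚ.* f ω) Ω)
  A²c² = A ℚ.* A ℚ.* (c ℚ.* c)
  tc≡1 : t ℚ.* c ≡ 1ℚ
  tc≡1 = ιn*1/n≡1 (suc (length Ω′))
  expand : ∀ A B c t →
    (B ℚ.- (A ℚ.* (A ℚ.* c) ℚ.+ A ℚ.* (A ℚ.* c)) ℚ.+ t ℚ.* (A ℚ.* c ℚ.* (A ℚ.* c))) ℚ.* c ≡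
    B ℚ.* c ℚ.- A ℚ.* A ℚ.* (c ℚ.* c) ℚ.- A ℚ.* A ℚ.* (c ℚ.* c) ℚ.+ t ℚ.* c ℚ.* (A ℚ.* A ℚ.* (c ℚ.* c))
  expand = solve 4 (λ A B c t →
    (B :- (A :* (A :* c) :+ A :* (A :* c)) :+ t :* (A :* c :* (A :* c))) :* c :=
    B :* c :- A :* A :* (c :* c) :- A :* A :* (c :* c) :+ t :* c :* (A :* A :* (c :* c))) refl
    where open +-*-Solver
  collapse : ∀ x y → x ℚ.- y ℚ.- y ℚ.+ 1ℚ ℚ.* y ≡ 1ℚ ℚ.* x ℚ.- y
  collapse = solve 2 (λ x y → x :- y :- y :+ con 1ℚ :* y := con 1ℚ :* x :- y) refl
    where open +-*-Solver
  factor : ∀ A B c t →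
    t ℚ.* c ℚ.* (B ℚ.* c) ℚ.- A ℚ.* A ℚ.* (c ℚ.* c) ≡ (t ℚ.* B ℚ.- A ℚ.* A) ℚ.* (c ℚ.* c)
  factor = solve 4 (λ A B c t →
    t :* c :* (B :* c) :- A :* A :* (c :* c) := (t :* B :- A :* A) :* (c :* c)) refl
    where open +-*-Solver
  cancel : ∀ A c t β →
    (A ℚ.* A ℚ.+ t ℚ.* t ℚ.* β ℚ.- A ℚ.* A) ℚ.* (c ℚ.* c) ≡ t ℚ.* c ℚ.* (t ℚ.* c) ℚ.* β
  cancel = solve 4 (λ A c t β →
    (A :* A :+ t :* t :* β :- A :* A) :* (c :* c) := t :* c :* (t :* c) :* β) refl
    where open +-*-Solver

-- Carries an inequality between natural numbers over to the rationals: the whole bound is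
-- multiplied by `w * w`.
Var-scaled-≤ : ∀ (Ω : List X) (s : X → ℕ) w K (f : X → ℚ) → (∀ ω → f ω ≡ ι (s ω) ℚ.* w) →
  let t = length Ω; s₁ = ∑ Ω s in
  t * ∑ Ω (λ ω → s ω * s ω) ≤ s₁ * s₁ + t * t * K →
  Var Ω f ℚ.≤ ι K ℚ.* (w ℚ.* w)
Var-scaled-≤ Ω s w K f f≡ bound = Var-≤ Ω f (ι K ℚ.* w²)
  (subst (ℚ._≤ ι K ℚ.* w²) (ℚ.*-zeroˡ w²) (*w²-mono (ι-mono-≤ z≤n)))
  (begin
  ι t ℚ.* sumℚ (map (λ ω → f ω ℚ.* f ω) Ω)
    ≡⟨ cong (ι t ℚ.*_) (sumℚ-ι* Ω (λ ω → s ω * s ω) w² _ f²≡) ⟩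
  ι t ℚ.* (ι s₂ ℚ.* w²)
    ≡⟨ ℚ.*-assoc (ι t) (ι s₂) w² ⟨
  ι t ℚ.* ι s₂ ℚ.* w²
    ≡⟨ cong (ℚ._* w²) (ι-* t s₂) ⟨
  ι (t * s₂) ℚ.* w²
    ≤⟨ *w²-mono (ι-mono-≤ bound) ⟩
  ι (s₁ * s₁ + t * t * K) ℚ.* w²
    ≡⟨ cong (ℚ._* w²) ι-bound ⟩
  (ι s₁ ℚ.* ι s₁ ℚ.+ ι t ℚ.* ι t ℚ.* ι K) ℚ.* w²
    ≡⟨ distribute (ι s₁) (ι t) (ι K) w ⟩
  ι s₁ ℚ.* w ℚ.* (ι s₁ ℚ.* w) ℚ.+ ι t ℚ.* ι t ℚ.* (ι K ℚ.* w²)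
    ≡⟨ cong (λ A → A ℚ.* A ℚ.+ ι t ℚ.* ι t ℚ.* (ι K ℚ.* w²)) (sumℚ-ι* Ω s w f f≡) ⟨
  sumℚ (map f Ω) ℚ.* sumℚ (map f Ω) ℚ.+ ι t ℚ.* ι t ℚ.* (ι K ℚ.* w²) ∎)
  where
  open ℚ.≤-Reasoning
  t  = length Ω
  s₁ = ∑ Ω s
  s₂ = ∑ Ω (λ ω → s ω * s ω)
  w² = w ℚ.* w
  *w²-mono : ∀ {p q} → p ℚ.≤ q → p ℚ.* w² ℚ.≤ q ℚ.* w²
  *w²-mono = ℚ.*-monoʳ-≤-nonNeg w² {{ℚ.nonNegative (0≤p*p w)}}
  interchange : ∀ x y u v → (x ℚ.* u) ℚ.* (y ℚ.* v) ≡ (x ℚ.* y) ℚ.* (u ℚ.* v)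
  interchange = solve 4 (λ x y u v → (x :* u) :* (y :* v) := (x :* y) :* (u :* v)) refl
    where open +-*-Solver
  f²≡ : ∀ ω → f ω ℚ.* f ω ≡ ι (s ω * s ω) ℚ.* w²
  f²≡ ω = trans (cong₂ ℚ._*_ (f≡ ω) (f≡ ω)) (trans (interchange (ι (s ω)) (ι (s ω)) w w)
    (cong (ℚ._* w²) (sym (ι-* (s ω) (s ω)))))
  ι-bound : ι (s₁ * s₁ + t * t * K) ≡ ι s₁ ℚ.* ι s₁ ℚ.+ ι t ℚ.* ι t ℚ.* ι K
  ι-bound = trans (ι-+ (s₁ * s₁) (t * t * K)) (cong₂ ℚ._+_ (ι-* s₁ s₁)
    (trans (ι-* (t * t) K) (cong (ℚ._* ι K) (ι-* t t))))
  distribute : ∀ a t K w →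
    (a ℚ.* a ℚ.+ t ℚ.* t ℚ.* K) ℚ.* (w ℚ.* w) ≡ a ℚ.* w ℚ.* (a ℚ.* w) ℚ.+ t ℚ.* t ℚ.* (K ℚ.* (w ℚ.* w))
  distribute = solve 4 (λ a t K w →
    (a :* a :+ t :* t :* K) :* (w :* w) := a :* w :* (a :* w) :+ t :* t :* (K :* (w :* w))) refl
    where open +-*-Solver

-- Comparison with a vanishing sequence.

archimedean : ∀ L ε → 0ℚ ℚ.< ε → ∃ λ n₁ → ∀ n → n ≥ n₁ → ι L ℚ.< ε ℚ.* ι n
-- For `ε = suc e / q` the threshold makes `L * q` less than `n`, hence less than `suc e * n`;
-- dividing by `q` gives the claim.
archimedean L ε@(mkℚ ℤ.+[1+ e ] q-1 _) _ = suc (L * q) , λ n Lq<n → ℚ.*-cancelʳ-<-nonNeg (ι q) (begin-strict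
  ι L ℚ.* ι q                      ≡⟨ ι-* L q ⟨
  ι (L * q)                        <⟨ ι-mono-< (≤-trans Lq<n (m≤n*m n (suc e))) ⟩
  ι (suc e * n)                    ≡⟨ ι-* (suc e) n ⟩
  ι (suc e) ℚ.* ι n                ≡⟨ cong (ℚ._* ι n) εq≡ ⟨
  ε ℚ.* ι q ℚ.* ι n                ≡⟨ ℚ.*-assoc ε (ι q) (ι n) ⟩
  ε ℚ.* (ι q ℚ.* ι n)              ≡⟨ cong (ε ℚ.*_) (ℚ.*-comm (ι q) (ι n)) ⟩
  ε ℚ.* (ι n ℚ.* ι q)              ≡⟨ ℚ.*-assoc ε (ι n) (ι q) ⟨
  ε ℚ.* ι n ℚ.* ι q                ∎)
  where
  open ℚ.≤-Reasoning
  q = suc q-1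
  εq≡ : ε ℚ.* ι q ≡ ι (suc e)
  εq≡ = begin-equality
    ε ℚ.* ι q                                  ≡⟨ cong (ℚ._* ι q) (ℚ.↥p/↧p≡p ε) ⟨
    (ℤ.+ suc e) ℚ./ q ℚ.* ι q                  ≡⟨ cong (ℚ._* ι q) (/≡ι*1/ (suc e) q) ⟩
    ι (suc e) ℚ.* (ℤ.+ 1 ℚ./ q) ℚ.* ι q        ≡⟨ ℚ.*-assoc (ι (suc e)) (ℤ.+ 1 ℚ./ q) (ι q) ⟩
    ι (suc e) ℚ.* ((ℤ.+ 1 ℚ./ q) ℚ.* ι q)      ≡⟨ cong (ι (suc e) ℚ.*_) (trans (ℚ.*-comm (ℤ.+ 1 ℚ./ q) (ι q)) (ιn*1/n≡1 q)) ⟩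
    ι (suc e) ℚ.* 1ℚ                           ≡⟨ ℚ.*-identityʳ (ι (suc e)) ⟩
    ι (suc e)                                  ∎
archimedean L (mkℚ ℤ.+0 _ _)       (*<* (ℤ.+<+ ()))
archimedean L (mkℚ ℤ.-[1+ _ ] _ _) (*<* ())

-- The rate `V ≤ L / n` is stated as a product, so that no division by `n` is required; the factors
-- `M` cancel against the reciprocals `w`.
*ι≤ι : ∀ V K L M n .{{_ : NonZero M}} → let w = ℤ.+ 1 ℚ./ M in
  V ℚ.≤ ι K ℚ.* (w ℚ.* w) → K * n ≤ L * (M * M) → V ℚ.* ι n ℚ.≤ ι L
*ι≤ι V K L M n V≤ Kn≤ = begin
  V ℚ.* ι n                              ≤⟨ ℚ.*-monoʳ-≤-nonNeg (ι n) V≤ ⟩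
  ι K ℚ.* w² ℚ.* ι n                     ≡⟨ swapʳ (ι K) w² (ι n) ⟩
  ι K ℚ.* ι n ℚ.* w²                     ≡⟨ cong (ℚ._* w²) (ι-* K n) ⟨
  ι (K * n) ℚ.* w²                       ≤⟨ ℚ.*-monoʳ-≤-nonNeg w² {{ℚ.nonNegative (0≤p*p w)}} (ι-mono-≤ Kn≤) ⟩
  ι (L * (M * M)) ℚ.* w²                 ≡⟨ cong (ℚ._* w²) (trans (ι-* L (M * M)) (cong (ι L ℚ.*_) (ι-* M M))) ⟩
  ι L ℚ.* (ι M ℚ.* ι M) ℚ.* w²           ≡⟨ regroup (ι L) (ι M) w ⟩
  ι L ℚ.* (ι M ℚ.* w ℚ.* (ι M ℚ.* w))    ≡⟨ cong (λ u → ι L ℚ.* (u ℚ.* u)) (ιn*1/n≡1 M) ⟩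
  ι L ℚ.* (1ℚ ℚ.* 1ℚ)                    ≡⟨ ℚ.*-identityʳ (ι L) ⟩
  ι L                                    ∎
  where
  open ℚ.≤-Reasoning
  w  = ℤ.+ 1 ℚ./ M
  w² = w ℚ.* w
  swapʳ : ∀ x y z → x ℚ.* y ℚ.* z ≡ x ℚ.* z ℚ.* y
  swapʳ = solve 3 (λ x y z → x :* y :* z := x :* z :* y) refl
    where open +-*-Solver
  regroup : ∀ x y z → x ℚ.* (y ℚ.* y) ℚ.* (z ℚ.* z) ≡ x ℚ.* (y ℚ.* z ℚ.* (y ℚ.* z))
  regroup = solve 3 (λ x y z → x :* (y :* y) :* (z :* z) := x :* (y :* z :* (y :* z))) refl
    where open +-*-Solver

-- Variance of the safe proportion on one board, and the limit.

module _ {k n : ℕ} .{{_ : NonZero n}} (R : AttackRule k n) where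

  safe# : List (Space k n) → ℕ
  safe# = unhit (attacksᵇ R) (spaces k n) (spaces k n)

  -- Variance of the number of safe spaces at most `K`, multiplied by the square of the number of
  -- placements so as to stay within the natural numbers.
  SecondMomentBound : ℕ → ℕ → Set
  SecondMomentBound N K = length Ω * ∑ Ω (λ ω → safe# ω * safe# ω) ≤
    ∑ Ω safe# * ∑ Ω safe# + length Ω * length Ω * K
    where Ω = placements k n N

  Var-safeProportion-≤ : ∀ N K → SecondMomentBound N K →
    let w = (ℤ.+ 1 ℚ./ n ^ k) {{m^n≢0 n k}} in
    Var (placements k n N) (safeProportion R) ℚ.≤ ι K ℚ.* (w ℚ.* w)
  Var-safeProportion-≤ N K bound = Var-scaled-≤ (placements k n N) safe# w K (safeProportion R) f≡ bound
    where
    instance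
      n^k≢0 : NonZero (n ^ k)
      n^k≢0 = m^n≢0 n k
    w = ℤ.+ 1 ℚ./ n ^ k
    f≡ : ∀ ω → safeProportion R ω ≡ ι (safe# ω) ℚ.* w
    f≡ ω = trans (/≡ι*1/ (safeCount R ω) (n ^ k)) (cong (λ s → ι s ℚ.* w) (safeCount≡unhit R ω))

  secondMomentBound-sparse : ∀ N D → (∀ p → attackCount R p ≡ D) → SecondMomentBound N (N * (D * D))
  secondMomentBound-sparse N D deg = unhit-secondMoment (attacksᵇ R) (spaces k n) (spaces k n) N D
    {{subst NonZero (sym (length-spaces k n)) (m^n≢0 n k)}}
    (λ p → ≤-reflexive (trans (sym (attackCount≡∑ R p)) (deg p)))

  -- A positive `N` provides a first piece, which already covers the board, so the number of safe
  -- spaces is identically zero.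
  secondMomentBound-full : ∀ N .{{_ : NonZero N}} → (∀ p → n ^ k ≤ attackCount R p) → SecondMomentBound N 0
  secondMomentBound-full (suc N) full
    rewrite ∑-choose-suc≡0 N (spaces k n) {λ ω → safe# ω * safe# ω} (λ p ω → cong (λ s → s * s)
      (unhit-∷≡0 (attacksᵇ R) (spaces k n) (spaces k n) p ω
        (subst₂ _≤_ (sym (length-spaces k n)) (attackCount≡∑ R p) (full p))))
    | *-zeroʳ (length (placements k n (suc N))) = z≤n

  -- The two regimes supply different `K`, but both satisfy one estimate, which says that `K` over
  -- the squared board size is at most `d * (a * a) / n`.
  secondMomentBound : ∀ m d a .{{_ : NonZero d}} .{{_ : NonZero a}} →
    (∀ p → attackCount R p ≡ a * n ^ m) →
    ∃ λ K → SecondMomentBound (d * n ^ (k ∸ m)) K × K * n ≤ d * (a * a) * (n ^ k * n ^ k)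
  secondMomentBound m d a deg with m <? k
  ... | yes m<k = _ , secondMomentBound-sparse (d * n ^ (k ∸ m)) (a * n ^ m) deg ,
    (begin
    d * n ^ (k ∸ m) * (a * n ^ m * (a * n ^ m)) * n
      ≡⟨ cong (λ e → d * n ^ e * (a * n ^ m * (a * n ^ m)) * n) k∸m≡ ⟩
    d * (n * n ^ j) * (a * n ^ m * (a * n ^ m)) * n
      -- With `k = suc j + m`, the exponent of `n` so far is `k + m + 1`; the factor `n ^ j`, at
      -- least one, raises it to `2 * k`.
      ≤⟨ m≤m*n _ (n ^ j) {{m^n≢0 n j}} ⟩
    d * (n * n ^ j) * (a * n ^ m * (a * n ^ m)) * n * n ^ j
      ≡⟨ regroup d n (n ^ j) a (n ^ m) ⟩
    d * (a * a) * (n * n ^ j * n ^ m * (n * n ^ j * n ^ m))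
      ≡⟨ cong (λ M → d * (a * a) * (M * M)) n^k≡ ⟨
    d * (a * a) * (n ^ k * n ^ k) ∎)
    where
    open ≤-Reasoning
    j = k ∸ suc m
    k∸m≡ : k ∸ m ≡ suc j
    k∸m≡ = +-∸-assoc 1 m<k
    n^k≡ : n ^ k ≡ n * n ^ j * n ^ m
    n^k≡ = trans (cong (n ^_) (sym (trans (cong (_+ m) (sym k∸m≡)) (m∸n+n≡m (<⇒≤ m<k)))))
                 (^-distribˡ-+-* n (suc j) m)
    regroup : ∀ d n p a q → d * (n * p) * (a * q * (a * q)) * n * p ≡ d * (a * a) * (n * p * q * (n * p * q))
    regroup = solve-∀
  -- Since `m ≥ k`, truncated subtraction makes the exponent zero, so there are `d` pieces, hence at
  -- least one, and each attacks at least `n ^ k` spaces.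
  ... | no m≮k = 0 , secondMomentBound-full (d * n ^ (k ∸ m)) {{N≢0}} full , z≤n
    where
    instance
      n^e≢0 : NonZero (n ^ (k ∸ m))
      n^e≢0 = m^n≢0 n (k ∸ m)
    N≢0 : NonZero (d * n ^ (k ∸ m))
    N≢0 = m*n≢0 d (n ^ (k ∸ m))
    full : ∀ p → n ^ k ≤ attackCount R p
    full p rewrite deg p = ≤-trans (^-monoʳ-≤ n (≮⇒≥ m≮k)) (m≤n*m (n ^ m) a)

theorem1p4 : (k m d a : ℕ) .{{_ : NonZero k}} .{{_ : NonZero m}} .{{_ : NonZero d}} .{{_ : NonZero a}} →
    (A : ∀ n → .{{_ : NonZero n}} → AttackRule k n) →
    (n₀ : ℕ) →
    (∀ n → .{{_ : NonZero n}} → n ≥ n₀ → ∀ p → attackCount (A n) p ≡ a * n ^ m) →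
    (λ n → Var (placements k n (d * n ^ (k ∸ m))) (safeProportion (A n))) ⟶ 0ℚ
theorem1p4 k m d a A n₀ deg ε 0<ε with archimedean (d * (a * a)) ε 0<ε
-- Beyond `n₀` the attack counts are as prescribed; beyond `n₁` the constant `d * (a * a)` is below
-- `ε` times `n`.
... | n₁ , arch = n₀ ⊔ n₁ , λ n n≥ → close n (m⊔n≤o⇒m≤o n₀ n₁ n≥) (m⊔n≤o⇒n≤o n₀ n₁ n≥)
  where
  variance : ∀ n → .{{NonZero n}} → ℚ
  variance n = Var (placements k n (d * n ^ (k ∸ m))) (safeProportion (A n))
  close : ∀ n → .{{_ : NonZero n}} → n ≥ n₀ → n ≥ n₁ → ℚ.∣ variance n ℚ.- 0ℚ ∣ ℚ.< ε
  close n n≥n₀ n≥n₁ with secondMomentBound (A n) m d a (deg n n≥n₀)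
  ... | K , bound , Kn≤ = subst (ℚ._< ε) (sym ∣V-0∣≡V)
    -- Both sides are compared after multiplication by `n`: the variance times `n` is at most
    -- `d * (a * a)`, which is less than `ε` times `n`.
    (ℚ.*-cancelʳ-<-nonNeg (ι n) (ℚ.≤-<-trans
      (*ι≤ι (variance n) K (d * (a * a)) (n ^ k) n {{m^n≢0 n k}}
        (Var-safeProportion-≤ (A n) (d * n ^ (k ∸ m)) K bound) Kn≤)
      (arch n n≥n₁)))
    where
    ∣V-0∣≡V : ℚ.∣ variance n ℚ.- 0ℚ ∣ ≡ variance n
    ∣V-0∣≡V = trans (cong ℚ.∣_∣ (ℚ.+-identityʳ (variance n)))
      (ℚ.0≤p⇒∣p∣≡p (Var-nonNeg (placements k n (d * n ^ (k ∸ m))) (safeProportion (A n))))
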